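{- Let $S$ be a uniformly recurrent laminary set on a finite alphabet $A$ relative to an involution $\theta$. Any finite symmetric bifix code $X\subset S$ is contained in a finite symmetric $S$-maximal bifix code.
   Context: Words are over a finite alphabet $A$. A set $S$ of words on $A$ is factorial if it contains $A$ and all the factors of its elements; it is biextendable if moreover for every $w\in S$ there are $a,b\in A$ with $awb\in S$. An infinite factorial set $S$ is uniformly recurrent if for every $u\in S$ there is an integer $n\ge1$ such that $u$ is a factor of every word of $S$ of length $n$. Let $\theta$ be an involution on $A$ (possibly with fixed points) and let $G_\theta$ be the group generated by $A$ with relations $a\theta(a)=1$, $a\in A$ (so $a^{ -1}=\theta(a)$). A word is reduced if it has no factor $a\theta(a)$ with $a\in A$; the inverse of a reduced word $a_1\cdots a_n$ is the reduced word $\theta(a_n)\cdots\theta(a_1)$. A laminary set on $A$ relative to $\theta$ is a biextendable set of reduced words closed under taking inverses. A set of reduced words is symmetric if it is closed under taking inverses. A bifix code is a set of nonempty words in which no element is a proper prefix or a proper suffix of another. A bifix code $X\subset S$ is $S$-maximal if it is not properly contained in a bifix code $Y\subset S$. -}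

module Defs where

open import Level using (0ℓ)
open import Data.List using (List; []; _∷_; [_]; _++_; length; map; reverse)
open import Data.List.Membership.Propositional using (_∈_)
open import Data.List.Relation.Binary.Infix.Heterogeneous using (Infix)
open import Data.List.Relation.Binary.Prefix.Heterogeneous using (Prefix)
open import Data.List.Relation.Binary.Suffix.Heterogeneous using (Suffix)
open import Data.Nat using (ℕ; _≤_)
open import Data.Product using (_×_; ∃; ∃₂)
open import Relation.Binary.PropositionalEquality using (_≡_; _≢_)
open import Relation.Nullary using (¬_)
open import Relation.Unary using (Pred; _⊆_; _⊄_; _≐_)

Word : Set → Set
Word A = List A

WordSet : Set → Set₁
WordSet A = Pred (Word A) 0ℓ

module _ {A : Set} where

  IsFactor IsPrefix IsSuffix : Word A → Word A → Set
  IsFactor = Infix _≡_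
  IsPrefix = Prefix _≡_
  IsSuffix = Suffix _≡_

  IsProperPrefix IsProperSuffix : Word A → Word A → Set
  IsProperPrefix u v = IsPrefix u v × u ≢ v
  IsProperSuffix u v = IsSuffix u v × u ≢ v

  Finite : WordSet A → Set
  Finite X = ∃ λ (ws : List (Word A)) → X ≐ (_∈ ws)

  record Factorial (S : WordSet A) : Set where
    field
      letters : ∀ (a : A) → S [ a ]
      factors : ∀ {u w : Word A} → S w → IsFactor u w → S u

  record Biextendable (S : WordSet A) : Set where
    field
      factorial : Factorial S
      extend    : ∀ {w : Word A} → S w → ∃₂ λ (a b : A) → S ([ a ] ++ w ++ [ b ])

  record UniformlyRecurrent (S : WordSet A) : Set where
    field
      factorial : Factorial S
      infinite  : ¬ Finite S
      recurrent : ∀ {u : Word A} → S u →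
                  ∃ λ (n : ℕ) → 1 ≤ n × (∀ {w : Word A} → S w → length w ≡ n → IsFactor u w)

  record BifixCode (X : WordSet A) : Set where
    field
      nonempty : ∀ {u : Word A} → X u → u ≢ []
      prefix   : ∀ {u v : Word A} → X u → X v → ¬ IsProperPrefix u v
      suffix   : ∀ {u v : Word A} → X u → X v → ¬ IsProperSuffix u v

  record MaximalBifixCode (S X : WordSet A) : Set₁ where
    field
      bifix    : BifixCode X
      included : X ⊆ S
      maximal  : ∀ (Y : WordSet A) → BifixCode Y → Y ⊆ S → X ⊄ Y

  -- θ is the involution a ↦ a⁻¹ on letters.
  module _ (θ : A → A) where

    Reduced : Word A → Set
    Reduced w = ∀ (a : A) → ¬ IsFactor (a ∷ θ a ∷ []) w

    inverse : Word A → Word A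
    inverse w = reverse (map θ w)

    Symmetric : WordSet A → Set
    Symmetric X = ∀ {w : Word A} → X w → X (inverse w)

    record Laminary (S : WordSet A) : Set where
      field
        biextendable : Biextendable S
        reduced      : ∀ {w : Word A} → S w → Reduced w
        symmetric    : Symmetric S

{-# OPTIONS --safe #-}

-- Let L w be the number of positions of w at which no word of X starts; since X
-- is bifix, this is also the number of positions at which no word of X ends
-- (and one less than the number of parses of w).  Hence L grows by 0 or 1 when
-- a letter is added on either side, growing by 0 on the right exactly when the
-- new word has a suffix in X.  As X is symmetric, L is invariant under inversion.
--
-- Take d at least the length of every word of X and truncate: M w = min(d, L w).
-- If L reaches d on S, let Y be the set of words w = vb of S with M w = M v and
-- no proper suffix with this property.  For w = avb of length at least 2,
-- M(avb) = M(av) and M(vb) ≠ M(v) together are equivalent to the mirror condition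
-- M(avb) = M(vb) and M(av) ≠ M(v), so Y is symmetric, hence bifix.  By uniform
-- recurrence every long word of S has a proper prefix on which L reaches d, so
-- it has a suffix in Y; thus Y is finite and S-maximal.  If L stays below d on S,
-- then it attains a maximum, and by the same argument every long word of S has
-- a suffix in X, so that X itself is S-maximal.

module Submission where

open import Defs
open import Level using (0ℓ)
open import Algebra.Definitions using (Involutive)
open import Axiom.ExcludedMiddle using (ExcludedMiddle)
open import Data.Empty using (⊥-elim)
open import Data.Fin using (Fin)
open import Data.List using (List; []; _∷_; [_]; _++_; _∷ʳ_; length; map; reverse; take; filter; allFin; cartesianProductWith; initLast; _∷ʳ′_)
open import Data.List.Extrema.Nat using (max; xs≤max)
open import Data.List.Membership.Propositional using (_∈_)
open import Data.List.Membership.Propositional.Properties using (∈-allFin; ∈-map⁺; ∈-filter⁺; ∈-filter⁻; ∈-cartesianProductWith⁺)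
open import Data.List.Properties using (unfold-reverse; reverse-++; reverse-involutive; reverse-map; ++-identityʳ; map-++; map-∘; map-id; map-cong; ∷-injectiveʳ; ∷ʳ-injectiveˡ; ∷ʳ-++; length-take; length-++)
open import Data.List.Relation.Binary.Infix.Heterogeneous using (here; there)
open import Data.List.Relation.Binary.Infix.Heterogeneous.Properties using (Infix-Prefix-trans)
open import Data.List.Relation.Binary.Pointwise using ([]; Pointwise-≡⇒≡; ≡⇒Pointwise-≡)
open import Data.List.Relation.Binary.Prefix.Heterogeneous using ([]; _∷_; _++ᵖ_)
import Data.List.Relation.Binary.Prefix.Heterogeneous as Prefix
import Data.List.Relation.Binary.Prefix.Heterogeneous.Properties as Prefix
open import Data.List.Relation.Binary.Suffix.Heterogeneous using (here; there)
import Data.List.Relation.Binary.Suffix.Heterogeneous as Suffix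
import Data.List.Relation.Binary.Suffix.Heterogeneous.Properties as Suffix
import Data.List.Relation.Unary.All as All
open import Data.List.Relation.Unary.Any using (here; there)
open import Data.Nat using (ℕ; zero; suc; _+_; _⊓_; _≤_; z≤n; s≤s)
open import Data.Nat.Properties using (≤-refl; ≤-trans; ≤-antisym; ≤-reflexive; ≤-pred; ≰⇒≥; ≰⇒>; <⇒≢; <⇒≱; n<1+n; n≤1+n; m≤n+m; +-comm; +-assoc; +-mono-≤; +-monoˡ-≤; ⊓-monoˡ-≤; ⊓-monoʳ-≤; m≤n⇒m⊓n≡m; m≥n⇒m⊓n≡n; ≤∧≢⇒<; _≤?_)
open import Data.Product using (_×_; ∃; ∃₂; _,_; proj₁; proj₂)
open import Data.Sum using (_⊎_; inj₁; inj₂)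
open import Function using (_∘_; id)
open import Function.Bundles using (_↔_; Inverse)
open import Relation.Binary.PropositionalEquality using (_≡_; _≢_; refl; sym; trans; cong; cong₂; subst; module ≡-Reasoning)
open import Relation.Nullary using (¬_; Dec; yes; no; contradiction)
open import Relation.Unary using (_⊆_)

-- Prefixes and suffixes of words.

module _ {A : Set} where

  prefix-refl : {u : Word A} → IsPrefix u u
  prefix-refl = Prefix.fromPointwise (≡⇒Pointwise-≡ refl)

  suffix-refl : {u : Word A} → IsSuffix u u
  suffix-refl = here (≡⇒Pointwise-≡ refl)

  suffix-∷⁻ : ∀ {u v : Word A} {a} → IsSuffix u (a ∷ v) → u ≡ a ∷ v ⊎ IsSuffix u v
  suffix-∷⁻ (here eqs)  = inj₁ (Pointwise-≡⇒≡ eqs)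
  suffix-∷⁻ (there suf) = inj₂ suf

  prefix-∷ʳ⁻ : ∀ {u : Word A} v {b} → IsPrefix u (v ∷ʳ b) → u ≡ v ∷ʳ b ⊎ IsPrefix u v
  prefix-∷ʳ⁻ []      []           = inj₂ []
  prefix-∷ʳ⁻ []      (refl ∷ [])  = inj₁ refl
  prefix-∷ʳ⁻ (a ∷ v) []           = inj₂ []
  prefix-∷ʳ⁻ (a ∷ v) (refl ∷ pre) with prefix-∷ʳ⁻ v pre
  ... | inj₁ refl = inj₁ refl
  ... | inj₂ pre′ = inj₂ (refl ∷ pre′)

  suffixes-comparable : ∀ {u v w : Word A} → IsSuffix u w → IsSuffix v w → IsSuffix u v ⊎ IsSuffix v u
  suffixes-comparable (here eqs) q with refl ← Pointwise-≡⇒≡ eqs = inj₂ q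
  suffixes-comparable (there p) (here eqs) with refl ← Pointwise-≡⇒≡ eqs = inj₁ (there p)
  suffixes-comparable (there p) (there q) = suffixes-comparable p q

  take-prefix : ∀ n (w : Word A) → IsPrefix (take n w) w
  take-prefix zero    w       = []
  take-prefix (suc n) []      = []
  take-prefix (suc n) (a ∷ w) = refl ∷ take-prefix n w

  length-∷ʳ : ∀ (v : Word A) b → length (v ∷ʳ b) ≡ suc (length v)
  length-∷ʳ v b = trans (length-++ v) (+-comm (length v) 1)

  []≢∷ʳ : ∀ (v : Word A) {b} → [] ≢ v ∷ʳ b
  []≢∷ʳ []      ()
  []≢∷ʳ (_ ∷ _) ()

  -- Suffix density, maximality and recurrence.

  module _ (S : WordSet A) where

    SuffixDense : WordSet A → Set
    SuffixDense Y = ∃ λ n → ∀ w → S w → n ≤ length w → ∃ λ y → Y y × IsSuffix y w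

    extend-left : Biextendable S → ∀ n {z} → S z → ∃ λ w → S w × IsSuffix z w × n ≤ length w
    extend-left bi zero    {z} Sz = z , Sz , suffix-refl , z≤n
    extend-left bi (suc n) Sz with w , Sw , suf , n≤ ← extend-left bi n Sz
      with a , b , Sawb ← Biextendable.extend bi Sw =
        a ∷ w , Factorial.factors (Biextendable.factorial bi) Sawb (here (refl ∷ (prefix-refl ++ᵖ [ b ])))
      , there suf , s≤s n≤

    -- Extend a word `z` of a larger bifix code `Z` to the left, inside `S`, until density provides
    -- a word `y` of `Y` ending at the same place. Of two suffixes of one word, one is a suffix of
    -- the other; as both lie in `Z`, they coincide.
    suffixDense⇒maximal : ExcludedMiddle 0ℓ → Biextendable S → ∀ {Y} → BifixCode Y → Y ⊆ S →
                          SuffixDense Y → MaximalBifixCode S Y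
    suffixDense⇒maximal em bi {Y} bifix Y⊆S (n , dense) = record
      { bifix    = bifix
      ; included = Y⊆S
      ; maximal  = λ Z bifixZ Z⊆S (Y⊆Z , Z⊈Y) → Z⊈Y (Z⊆Y Z bifixZ Z⊆S Y⊆Z)
      }
      where
      Z⊆Y : ∀ Z → BifixCode Z → Z ⊆ S → Y ⊆ Z → Z ⊆ Y
      Z⊆Y Z bifixZ Z⊆S Y⊆Z {z} Zz
        with w , Sw , z≼w , n≤ ← extend-left bi n (Z⊆S Zz)
        with y , Yy , y≼w ← dense w Sw n≤
        with em {y ≡ z}
      ... | yes refl = Yy
      ... | no y≢z with suffixes-comparable y≼w z≼w
      ...   | inj₁ y≼z = ⊥-elim (BifixCode.suffix bifixZ (Y⊆Z Yy) Zz (y≼z , y≢z))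
      ...   | inj₂ z≼y = ⊥-elim (BifixCode.suffix bifixZ Zz (Y⊆Z Yy) (z≼y , y≢z ∘ sym))

    -- Recurrence speaks of words of length exactly `n`; a longer word is handled through its prefix
    -- of length `n`.
    recurrent-factor : (ur : UniformlyRecurrent S) → ∀ {u} → S u →
                       ∃ λ n → ∀ {w} → S w → n ≤ length w → IsFactor u w
    recurrent-factor ur Su with n , _ , occurs ← UniformlyRecurrent.recurrent ur Su =
      n , λ {w} Sw n≤ → Infix-Prefix-trans trans
        (occurs (Factorial.factors (UniformlyRecurrent.factorial ur) Sw (here (take-prefix n w)))
                (trans (length-take n w) (m≤n⇒m⊓n≡m n≤)))
        (take-prefix n w)

    recurrent-factor-init : (ur : UniformlyRecurrent S) → ∀ {u} → S u →
                            ∃ λ n → ∀ v b → S (v ∷ʳ b) → n ≤ length (v ∷ʳ b) → IsFactor u v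
    recurrent-factor-init ur Su with n , occurs ← recurrent-factor ur Su =
      -- The successor pays for the last letter `b`, which is dropped.
      suc n , λ v b Svb n< → occurs
        (Factorial.factors (UniformlyRecurrent.factorial ur) Svb (here (prefix-refl ++ᵖ [ b ])))
        (≤-pred (≤-trans n< (≤-reflexive (length-∷ʳ v b))))

    -- The empty word is a factor of every word, so without it `S` would be empty and hence finite.
    []∈S : ExcludedMiddle 0ℓ → UniformlyRecurrent S → S []
    []∈S em ur with em {S []}
    ... | yes S[] = S[]
    ... | no ¬S[] = ⊥-elim (UniformlyRecurrent.infinite ur
          ([] , (λ Sw → ⊥-elim (¬S[] (Factorial.factors (UniformlyRecurrent.factorial ur) Sw (here [])))) , λ ()))

  -- Finite sets of words and bounded length.

  length-bound : ∀ {X : WordSet A} → Finite X → ∃ λ d → ∀ {x} → X x → length x ≤ d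
  length-bound (ws , X⊆ws , _) =
    max 0 (map length ws) , λ Xx → All.lookup (xs≤max 0 (map length ws)) (∈-map⁺ length (X⊆ws Xx))

  wordsUpTo : List A → ℕ → List (Word A)
  wordsUpTo as zero    = [ [] ]
  wordsUpTo as (suc n) = [] ∷ cartesianProductWith _∷_ as (wordsUpTo as n)

  ∈-wordsUpTo : ∀ {as} → (∀ a → a ∈ as) → ∀ {n} w → length w ≤ n → w ∈ wordsUpTo as n
  ∈-wordsUpTo all {zero}  []      _        = here refl
  ∈-wordsUpTo all {suc n} []      _        = here refl
  ∈-wordsUpTo all {suc n} (a ∷ w) (s≤s le) =
    there (∈-cartesianProductWith⁺ _∷_ (all a) (∈-wordsUpTo all w le))

  bounded⇒finite : ExcludedMiddle 0ℓ → ∀ {k} → A ↔ Fin k → ∀ {Y : WordSet A} n →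
                   (∀ {w} → Y w → length w ≤ n) → Finite Y
  bounded⇒finite em {k} A↔k {Y} n bound =
      filter Y? words
    , (λ {w} Yw → ∈-filter⁺ Y? (∈-wordsUpTo letter∈ w (bound Yw)) Yw)
    , λ w∈ → proj₂ (∈-filter⁻ Y? {xs = words} w∈)
    where
    open Inverse A↔k
    alphabet : List A
    alphabet = map from (allFin k)
    words : List (Word A)
    words = wordsUpTo alphabet n
    letter∈ : ∀ a → a ∈ alphabet
    letter∈ a = subst (_∈ alphabet) (strictlyInverseʳ a) (∈-map⁺ from (∈-allFin (to a)))
    Y? : ∀ w → Dec (Y w)
    Y? _ = em

  -- Inversion of words.

  module _ (θ : A → A) where

    inverse-∷ : ∀ a w → inverse θ (a ∷ w) ≡ inverse θ w ∷ʳ θ a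
    inverse-∷ a w = unfold-reverse (θ a) (map θ w)

    inverse-∷ʳ : ∀ w b → inverse θ (w ∷ʳ b) ≡ θ b ∷ inverse θ w
    inverse-∷ʳ w b = trans (cong reverse (map-++ θ w [ b ])) (reverse-++ (map θ w) [ θ b ])

    inverse-prefix : ∀ {u v} → IsPrefix u v → IsSuffix (inverse θ u) (inverse θ v)
    inverse-prefix pre = Suffix.fromPrefix (Prefix.map⁺ θ θ (Prefix.map (cong θ) pre))

    inverse-suffix : ∀ {u v} → IsSuffix u v → IsPrefix (inverse θ u) (inverse θ v)
    inverse-suffix suf = Suffix.toPrefix-rev (Suffix.map⁺ θ θ (Suffix.map (cong θ) suf))

    module _ (θ-inv : Involutive _≡_ θ) where

      inverse-involutive : ∀ w → inverse θ (inverse θ w) ≡ w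
      inverse-involutive w = begin
        reverse (map θ (reverse (map θ w)))  ≡⟨ cong reverse (reverse-map θ (map θ w)) ⟩
        reverse (reverse (map θ (map θ w)))  ≡⟨ reverse-involutive _ ⟩
        map θ (map θ w)                      ≡⟨ map-∘ w ⟨
        map (θ ∘ θ) w                        ≡⟨ map-cong θ-inv w ⟩
        map id w                             ≡⟨ map-id w ⟩
        w                                    ∎
        where open ≡-Reasoning

      -- Inversion turns a proper prefix into a proper suffix, so the suffix condition suffices for
      -- a symmetric set.
      symmetric-suffix⇒bifix : ∀ {Y : WordSet A} → Symmetric θ Y → (∀ {u} → Y u → u ≢ []) →
                               (∀ {u v} → Y u → Y v → ¬ IsProperSuffix u v) → BifixCode Y
      symmetric-suffix⇒bifix symY ne suf = record
        { nonempty = ne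
        ; prefix   = λ {u} {v} Yu Yv (pre , u≢v) → suf (symY Yu) (symY Yv)
            (inverse-prefix pre , λ eq → u≢v (trans (sym (inverse-involutive u)) (trans (cong (inverse θ) eq) (inverse-involutive v))))
        ; suffix   = suf
        }

-- Counting failures of a proposition.

module Indicator (em : ExcludedMiddle 0ℓ) where

  cost : Set → ℕ
  cost P with em {P}
  ... | yes _ = 0
  ... | no  _ = 1

  cost-yes : ∀ {P} → P → cost P ≡ 0
  cost-yes {P} p with em {P}
  ... | yes _ = refl
  ... | no ¬p = contradiction p ¬p

  cost-no : ∀ {P} → ¬ P → cost P ≡ 1
  cost-no {P} ¬p with em {P}
  ... | yes p = contradiction p ¬p
  ... | no _  = refl

  cost≤1 : ∀ P → cost P ≤ 1
  cost≤1 P with em {P}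
  ... | yes _ = z≤n
  ... | no  _ = ≤-refl

  cost-cong : ∀ {P Q} → (P → Q) → (Q → P) → cost P ≡ cost Q
  cost-cong {P} {Q} f g with em {Q}
  ... | yes q = cost-yes (g q)
  ... | no ¬q = cost-no (¬q ∘ f)

-- The number `L` of positions where no word of `X` starts.

module Parses (em : ExcludedMiddle 0ℓ) {A : Set} (X : WordSet A) (bifix : BifixCode X) where

  open Indicator em

  HasPrefix HasSuffix : Word A → Set
  HasPrefix w = ∃ λ x → X x × IsPrefix x w
  HasSuffix w = ∃ λ x → X x × IsSuffix x w

  L : Word A → ℕ
  L []      = 0
  L (a ∷ w) = cost (HasPrefix (a ∷ w)) + L w

  -- Among the occurrences of words of X in bva, only bva itself is neither an
  -- occurrence in bv nor one in va.
  cost-exchange : ∀ b v a → cost (HasPrefix (b ∷ v ∷ʳ a)) + cost (HasSuffix (v ∷ʳ a)) ≡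
                            cost (HasPrefix (b ∷ v)) + cost (HasSuffix (b ∷ v ∷ʳ a))
  cost-exchange b v a with em {X (b ∷ v ∷ʳ a)}
  ... | yes Xw
    rewrite cost-yes {HasPrefix (b ∷ v ∷ʳ a)} (_ , Xw , prefix-refl)
          | cost-yes {HasSuffix (b ∷ v ∷ʳ a)} (_ , Xw , suffix-refl)
          | cost-no {HasSuffix (v ∷ʳ a)} (λ (x , Xx , suf) →
              BifixCode.suffix bifix Xx Xw (there suf , λ { refl → <⇒≱ (n<1+n _) (Suffix.length-mono suf) }))
          | cost-no {HasPrefix (b ∷ v)} (λ (x , Xx , pre) →
              BifixCode.prefix bifix Xx Xw (pre ++ᵖ [ a ] , λ { refl → <⇒≱ (s≤s (≤-reflexive (sym (length-∷ʳ v a)))) (Prefix.length-mono pre) }))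
    = refl
  ... | no ¬Xw = cong₂ _+_ (cost-cong shrink (λ (x , Xx , pre) → x , Xx , pre ++ᵖ [ a ]))
                           (cost-cong (λ (x , Xx , suf) → x , Xx , there suf) shrinkˢ)
    where
    shrink : HasPrefix (b ∷ v ∷ʳ a) → HasPrefix (b ∷ v)
    shrink (x , Xx , pre) with prefix-∷ʳ⁻ (b ∷ v) pre
    ... | inj₁ refl = contradiction Xx ¬Xw
    ... | inj₂ pre′ = x , Xx , pre′
    shrinkˢ : HasSuffix (b ∷ v ∷ʳ a) → HasSuffix (v ∷ʳ a)
    shrinkˢ (x , Xx , suf) with suffix-∷⁻ suf
    ... | inj₁ refl = contradiction Xx ¬Xw
    ... | inj₂ suf′ = x , Xx , suf′

  -- This passes from counting starts to counting ends. In the induction on the first letter,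
  -- `cost-exchange` moves the change at the left end to the right end.
  L-∷ʳ : ∀ w a → L (w ∷ʳ a) ≡ cost (HasSuffix (w ∷ʳ a)) + L w
  L-∷ʳ []      a = cong (_+ 0) (cost-cong to from)
    where
    to : HasPrefix [ a ] → HasSuffix [ a ]
    to (x , Xx , pre) with prefix-∷ʳ⁻ [] pre
    ... | inj₁ refl = x , Xx , suffix-refl
    ... | inj₂ []   = contradiction refl (BifixCode.nonempty bifix Xx)
    from : HasSuffix [ a ] → HasPrefix [ a ]
    from (x , Xx , suf) with suffix-∷⁻ suf
    ... | inj₁ refl      = x , Xx , prefix-refl
    ... | inj₂ (here []) = contradiction refl (BifixCode.nonempty bifix Xx)
  L-∷ʳ (b ∷ v) a = begin
    cost (HasPrefix (b ∷ v ∷ʳ a)) + L (v ∷ʳ a)                           ≡⟨ cong (cost (HasPrefix (b ∷ v ∷ʳ a)) +_) (L-∷ʳ v a) ⟩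
    cost (HasPrefix (b ∷ v ∷ʳ a)) + (cost (HasSuffix (v ∷ʳ a)) + L v)    ≡⟨ +-assoc (cost (HasPrefix (b ∷ v ∷ʳ a))) _ _ ⟨
    cost (HasPrefix (b ∷ v ∷ʳ a)) + cost (HasSuffix (v ∷ʳ a)) + L v      ≡⟨ cong (_+ L v) (cost-exchange b v a) ⟩
    cost (HasPrefix (b ∷ v)) + cost (HasSuffix (b ∷ v ∷ʳ a)) + L v       ≡⟨ cong (_+ L v) (+-comm (cost (HasPrefix (b ∷ v))) _) ⟩
    cost (HasSuffix (b ∷ v ∷ʳ a)) + cost (HasPrefix (b ∷ v)) + L v       ≡⟨ +-assoc (cost (HasSuffix (b ∷ v ∷ʳ a))) _ _ ⟩
    cost (HasSuffix (b ∷ v ∷ʳ a)) + L (b ∷ v)                            ∎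
    where open ≡-Reasoning

  L-∷-mono : ∀ a w → L w ≤ L (a ∷ w)
  L-∷-mono a w = m≤n+m (L w) _

  L-∷-step : ∀ a w → L (a ∷ w) ≤ suc (L w)
  L-∷-step a w = +-monoˡ-≤ (L w) (cost≤1 _)

  L-∷ʳ-mono : ∀ w a → L w ≤ L (w ∷ʳ a)
  L-∷ʳ-mono w a = subst (L w ≤_) (sym (L-∷ʳ w a)) (m≤n+m (L w) _)

  L-∷ʳ-step : ∀ w a → L (w ∷ʳ a) ≤ suc (L w)
  L-∷ʳ-step w a = subst (_≤ suc (L w)) (sym (L-∷ʳ w a)) (+-monoˡ-≤ (L w) (cost≤1 _))

  L≤length : ∀ w → L w ≤ length w
  L≤length []      = z≤n
  L≤length (a ∷ w) = +-mono-≤ (cost≤1 _) (L≤length w)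

  L-++-mono : ∀ u v → L u ≤ L (u ++ v)
  L-++-mono u []      = ≤-reflexive (cong L (sym (++-identityʳ u)))
  L-++-mono u (b ∷ v) = ≤-trans (L-∷ʳ-mono u b)
    (subst (λ w → L (u ∷ʳ b) ≤ L w) (∷ʳ-++ u b v) (L-++-mono (u ∷ʳ b) v))

  L-prefix-mono : ∀ {u w} → IsPrefix u w → L u ≤ L w
  L-prefix-mono {u} pre with Prefix.toView pre
  ... | Prefix._++_ eqs v
    with refl ← Pointwise-≡⇒≡ eqs = L-++-mono u v

  L-factor-mono : ∀ {u w} → IsFactor u w → L u ≤ L w
  L-factor-mono (here pre)              = L-prefix-mono pre
  L-factor-mono (there {b} {_} {w} inf) = ≤-trans (L-factor-mono inf) (L-∷-mono b w)

  module _ (θ : A → A) (θ-inv : Involutive _≡_ θ) (symX : Symmetric θ X) where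

    -- Inversion exchanges starts and ends of words of `X`, and by `L-∷ʳ` either kind of position
    -- gives the same count.
    L-inverse : ∀ w → L (inverse θ w) ≡ L w
    L-inverse []      = refl
    L-inverse (a ∷ w) = begin
      L (inverse θ (a ∷ w))                                        ≡⟨ cong L (inverse-∷ θ a w) ⟩
      L (inverse θ w ∷ʳ θ a)                                       ≡⟨ L-∷ʳ (inverse θ w) (θ a) ⟩
      cost (HasSuffix (inverse θ w ∷ʳ θ a)) + L (inverse θ w)      ≡⟨ cong₂ _+_ (cost-cong to from) (L-inverse w) ⟩
      cost (HasPrefix (a ∷ w)) + L w                               ∎
      where
      open ≡-Reasoning
      to : HasSuffix (inverse θ w ∷ʳ θ a) → HasPrefix (a ∷ w)
      to (x , Xx , suf) = inverse θ x , symX Xx ,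
        subst (IsPrefix (inverse θ x)) (inverse-involutive θ θ-inv (a ∷ w))
          (inverse-suffix θ (subst (IsSuffix x) (sym (inverse-∷ θ a w)) suf))
      from : HasPrefix (a ∷ w) → HasSuffix (inverse θ w ∷ʳ θ a)
      from (x , Xx , pre) = inverse θ x , symX Xx ,
        subst (IsSuffix (inverse θ x)) (inverse-∷ θ a w) (inverse-prefix θ pre)

  -- Raise the threshold one unit at a time: if some word reaches `d` and none reaches `suc d`, that
  -- word attains the maximum.
  reaches-or-max : (S : WordSet A) → S [] → ∀ d →
                   (∃ λ u → S u × d ≤ L u) ⊎ (∃ λ u → S u × ∀ {v} → S v → L v ≤ L u)
  reaches-or-max S S[] zero    = inj₁ ([] , S[] , z≤n)
  reaches-or-max S S[] (suc d) with reaches-or-max S S[] d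
  ... | inj₂ attained = inj₂ attained
  ... | inj₁ (u , Su , d≤) with em {∃ λ u → S u × suc d ≤ L u}
  ...   | yes reached = inj₁ reached
  ...   | no ¬reached = inj₂ (u , Su , λ {v} Sv → ≤-trans (≤-pred (≰⇒> λ lt → ¬reached (v , Sv , lt))) d≤)

  L-stationary⇒HasSuffix : ∀ v b → L (v ∷ʳ b) ≤ L v → HasSuffix (v ∷ʳ b)
  L-stationary⇒HasSuffix v b le with em {HasSuffix (v ∷ʳ b)}
  ... | yes has = has
  ... | no ¬has = contradiction
    (≤-trans (≤-reflexive (sym (trans (L-∷ʳ v b) (cong (_+ L v) (cost-no ¬has))))) le) (<⇒≱ (n<1+n _))

  -- In a long word `v ∷ʳ b` of `S` the part `v` contains `u`, so `L v` is already maximal; the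
  -- letter `b` cannot raise it, which forces a suffix in `X`.
  max⇒suffixDense : ∀ {S : WordSet A} → UniformlyRecurrent S →
                    ∀ {u} → S u → (∀ {v} → S v → L v ≤ L u) → SuffixDense S X
  max⇒suffixDense {S} ur Su maxu with recurrent-factor-init S ur Su
  -- The successor excludes the empty word, which has no last letter.
  ... | n , occurs = suc n , dense
    where
    dense : ∀ w → S w → suc n ≤ length w → HasSuffix w
    dense w Sw n< with initLast w
    ... | v ∷ʳ′ b = L-stationary⇒HasSuffix v b
      (≤-trans (maxu Sw) (L-factor-mono (occurs v b Sw (≤-trans (n≤1+n n) n<))))

  -- The truncated count `M` and its minimal stationary words.

  module Truncation (d : ℕ) where

    M : Word A → ℕ
    M w = d ⊓ L w

    ⊓-suc : ∀ n → d ⊓ suc n ≤ suc (d ⊓ n)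
    ⊓-suc n = ⊓-monoˡ-≤ (suc n) (n≤1+n d)

    M-∷-mono : ∀ a w → M w ≤ M (a ∷ w)
    M-∷-mono a w = ⊓-monoʳ-≤ d (L-∷-mono a w)

    M-∷-step : ∀ a w → M (a ∷ w) ≤ suc (M w)
    M-∷-step a w = ≤-trans (⊓-monoʳ-≤ d (L-∷-step a w)) (⊓-suc (L w))

    M-∷ʳ-mono : ∀ w b → M w ≤ M (w ∷ʳ b)
    M-∷ʳ-mono w b = ⊓-monoʳ-≤ d (L-∷ʳ-mono w b)

    -- The existential form makes the condition false for the empty word.
    Stationary : Word A → Set
    Stationary w = ∃₂ λ v b → w ≡ v ∷ʳ b × M w ≡ M v

    ¬stationary-[] : ¬ Stationary []
    ¬stationary-[] (v , _ , eq , _) = []≢∷ʳ v eq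

    stationary-∷ʳ⁻ : ∀ v {b} → Stationary (v ∷ʳ b) → M (v ∷ʳ b) ≡ M v
    stationary-∷ʳ⁻ v (v′ , _ , eq , eqM) = trans eqM (cong M (sym (∷ʳ-injectiveˡ v v′ eq)))

    saturated⇒stationary : ∀ v b → d ≤ L v → Stationary (v ∷ʳ b)
    saturated⇒stationary v b d≤ = v , b , refl ,
      trans (m≤n⇒m⊓n≡m (≤-trans d≤ (L-∷ʳ-mono v b))) (sym (m≤n⇒m⊓n≡m d≤))

    HasSuffix⇒stationary : ∀ v b → HasSuffix (v ∷ʳ b) → Stationary (v ∷ʳ b)
    HasSuffix⇒stationary v b has = v , b , refl ,
      cong (d ⊓_) (trans (L-∷ʳ v b) (cong (_+ L v) (cost-yes has)))

    -- If `L v` is below `d`, then `L (v ∷ʳ b)` is at most `d`, so truncation changes neither value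
    -- and equality of `M` is equality of `L`.
    stationary⇒saturated∨HasSuffix : ∀ v b → Stationary (v ∷ʳ b) → d ≤ L v ⊎ HasSuffix (v ∷ʳ b)
    stationary⇒saturated∨HasSuffix v b st with d ≤? L v
    ... | yes d≤ = inj₁ d≤
    ... | no d≰ = inj₂ (L-stationary⇒HasSuffix v b (≤-reflexive (begin
      L (v ∷ʳ b)      ≡⟨ m≥n⇒m⊓n≡n (≤-trans (L-∷ʳ-step v b) (≰⇒> d≰)) ⟨
      d ⊓ L (v ∷ʳ b)  ≡⟨ stationary-∷ʳ⁻ v st ⟩
      d ⊓ L v         ≡⟨ m≥n⇒m⊓n≡n (≰⇒≥ d≰) ⟩
      L v             ∎)))
      where open ≡-Reasoning

    -- Both causes of stationarity, saturation and a suffix in `X`, survive a letter added on the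
    -- left.
    stationary-∷ : ∀ a {w} → Stationary w → Stationary (a ∷ w)
    stationary-∷ a st@(v , b , refl , _) with stationary⇒saturated∨HasSuffix v b st
    ... | inj₁ d≤             = saturated⇒stationary (a ∷ v) b (≤-trans d≤ (L-∷-mono a v))
    ... | inj₂ (x , Xx , suf) = HasSuffix⇒stationary (a ∷ v) b (x , Xx , there suf)

    stationary-suffix : ∀ {u w} → IsSuffix u w → Stationary u → Stationary w
    stationary-suffix (here eqs)  st with refl ← Pointwise-≡⇒≡ eqs = st
    stationary-suffix (there suf) st = stationary-∷ _ (stationary-suffix suf st)

    -- Only the suffix without the first letter is tested: by `stationary-∷` this rules out every
    -- shorter suffix as well.
    record Minimal (S : WordSet A) (w : Word A) : Set where
      constructor minimal
      field
        inS         : S w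
        stationary  : Stationary w
        ¬stationary : ∀ {a v} → w ≡ a ∷ v → ¬ Stationary v

    open Minimal

    minimal-nonempty : ∀ {S u} → Minimal S u → u ≢ []
    minimal-nonempty Yu refl = ¬stationary-[] (stationary Yu)

    minimal-suffix : ∀ {S u v} → Minimal S u → Minimal S v → ¬ IsProperSuffix u v
    minimal-suffix Yu Yv (here eqs , u≢v)  = u≢v (Pointwise-≡⇒≡ eqs)
    minimal-suffix Yu Yv (there suf , u≢v) = ¬stationary Yv refl (stationary-suffix suf (stationary Yu))

    -- Strip first letters as long as the rest is stationary; this stops because the empty word is
    -- not.
    minimal-exists : ∀ {S} → Factorial S → ∀ w → S w → Stationary w → ∃ λ y → Minimal S y × IsSuffix y w
    minimal-exists fact []      Sw st = contradiction st ¬stationary-[]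
    minimal-exists fact (a ∷ v) Sw st with em {Stationary v}
    ... | no ¬st = a ∷ v , minimal Sw st (λ { refl → ¬st }) , suffix-refl
    ... | yes st′ with y , Yy , suf ← minimal-exists fact v (Factorial.factors fact Sw (there (here prefix-refl))) st′ =
      y , Yy , there suf

    -- The choice of `d` enters here: within a word of `X`, saturation comes too late to make a
    -- proper suffix stationary, and a proper suffix in `X` is excluded by the bifix condition.
    X⊆Minimal : ∀ {S} → X ⊆ S → (∀ {x} → X x → length x ≤ d) → X ⊆ Minimal S
    X⊆Minimal {S} X⊆S short {x} Xx = minimal (X⊆S Xx) (st x Xx) ¬st
      where
      st : ∀ x → X x → Stationary x
      st x Xx with initLast x
      ... | []      = contradiction refl (BifixCode.nonempty bifix Xx)
      ... | v ∷ʳ′ b = HasSuffix⇒stationary v b (_ , Xx , suffix-refl)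
      ¬st : ∀ {a v} → x ≡ a ∷ v → ¬ Stationary v
      ¬st {a} refl st@(v , b , refl , _) with stationary⇒saturated∨HasSuffix v b st
      -- Here `d ≤ L v ≤ length v`, while the whole word has two more letters than `v` and length at
      -- most `d`.
      ... | inj₁ d≤ = <⇒≱ (s≤s (≤-trans (L≤length v) (≤-trans (n≤1+n _) (≤-reflexive (sym (length-∷ʳ v b))))))
                          (≤-trans (short Xx) d≤)
      ... | inj₂ (y , Xy , suf) = BifixCode.suffix bifix Xy Xx
              (there suf , λ { refl → <⇒≱ (n<1+n _) (Suffix.length-mono suf) })

    -- Symmetry of the set of minimal words.

    module _ (θ : A → A) (θ-inv : Involutive _≡_ θ) (symX : Symmetric θ X) where

      M-inverse : ∀ w → M (inverse θ w) ≡ M w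
      M-inverse w = cong (d ⊓_) (L-inverse θ θ-inv symX w)

      -- As `M` is invariant under inversion, minimality of the inverse of `avb` is a condition on
      -- `avb` with left and right exchanged.
      minimal-symmetric : ∀ {S} → Symmetric θ S → Symmetric θ (Minimal S)
      minimal-symmetric {S} symS {[]} Yw = contradiction refl (minimal-nonempty Yw)
      minimal-symmetric {S} symS {a ∷ u} Yw with initLast u
      -- For a single letter, the last letter is also the first, and the remaining word is empty.
      ... | [] = minimal (symS (inS Yw))
        ([] , θ a , refl , trans (M-inverse [ a ]) (stationary-∷ʳ⁻ [] (stationary Yw)))
        (λ { refl → ¬stationary-[] })
      ... | v ∷ʳ′ b = minimal (symS (inS Yw))
        (inverse θ (v ∷ʳ b) , θ a , inverse-∷ θ a (v ∷ʳ b) ,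
          trans (M-inverse (a ∷ v ∷ʳ b)) (trans M-avb≡M-vb (sym (M-inverse (v ∷ʳ b)))))
        ¬st
        where
        M-avb≡M-av : M (a ∷ v ∷ʳ b) ≡ M (a ∷ v)
        M-avb≡M-av = stationary-∷ʳ⁻ (a ∷ v) (stationary Yw)
        M-v<M-vb : suc (M v) ≤ M (v ∷ʳ b)
        M-v<M-vb = ≤∧≢⇒< (M-∷ʳ-mono v b) (λ eq → ¬stationary Yw refl (v , b , refl , sym eq))
        -- The chain `M v + 1 ≤ M vb ≤ M avb = M av ≤ M v + 1` collapses to equalities, giving both
        -- halves of the mirror condition.
        M-avb≡M-vb : M (a ∷ v ∷ʳ b) ≡ M (v ∷ʳ b)
        M-avb≡M-vb = ≤-antisym
          (≤-trans (≤-reflexive M-avb≡M-av) (≤-trans (M-∷-step a v) M-v<M-vb))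
          (M-∷-mono a (v ∷ʳ b))
        M-v≢M-av : M v ≢ M (a ∷ v)
        M-v≢M-av = <⇒≢ (≤-trans M-v<M-vb (≤-trans (M-∷-mono a (v ∷ʳ b)) (≤-reflexive M-avb≡M-av)))
        -- The tail `t` is the inverse of `av`, so its stationarity would mean `M av = M v`.
        ¬st : ∀ {c t} → inverse θ (a ∷ v ∷ʳ b) ≡ c ∷ t → ¬ Stationary t
        ¬st {c} {t} eq st = M-v≢M-av (begin
          M v                    ≡⟨ M-inverse v ⟨
          M (inverse θ v)        ≡⟨ stationary-∷ʳ⁻ (inverse θ v) (subst Stationary t≡ st) ⟨
          M (inverse θ v ∷ʳ θ a) ≡⟨ cong M (inverse-∷ θ a v) ⟨
          M (inverse θ (a ∷ v))  ≡⟨ M-inverse (a ∷ v) ⟩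
          M (a ∷ v)              ∎)
          where
          open ≡-Reasoning
          t≡ : t ≡ inverse θ v ∷ʳ θ a
          t≡ = trans (∷-injectiveʳ (trans (sym eq) (inverse-∷ʳ θ (a ∷ v) b))) (inverse-∷ θ a v)

    -- Density and boundedness of the minimal words.

    module _ {S : WordSet A} (ur : UniformlyRecurrent S) {u : Word A} (Su : S u) (d≤Lu : d ≤ L u) where

      -- A long word contains `u` before its last letter, so `M` is saturated there already.
      long⇒stationary : ∃ λ n → ∀ w → S w → n ≤ length w → Stationary w
      long⇒stationary with recurrent-factor-init S ur Su
      ... | n , occurs = suc n , st
        where
        st : ∀ w → S w → suc n ≤ length w → Stationary w
        st w Sw n< with initLast w
        ... | v ∷ʳ′ b = saturated⇒stationary v b
          (≤-trans d≤Lu (L-factor-mono (occurs v b Sw (≤-trans (n≤1+n n) n<))))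

      minimal-suffixDense : SuffixDense S (Minimal S)
      minimal-suffixDense with n , st ← long⇒stationary =
        n , λ w Sw n≤ → minimal-exists (UniformlyRecurrent.factorial ur) w Sw (st w Sw n≤)

      minimal-bounded : ∃ λ n → ∀ {w} → Minimal S w → length w ≤ n
      minimal-bounded with long⇒stationary
      ... | n , st = n , bound _
        where
        bound : ∀ w → Minimal S w → length w ≤ n
        bound []      Yw = z≤n
        -- If `v` had length at least `n` it would be stationary, against minimality of `a ∷ v`.
        bound (a ∷ v) Yw = ≰⇒> λ n≤ → ¬stationary Yw refl
          (st v (Factorial.factors (UniformlyRecurrent.factorial ur) (inS Yw) (there (here prefix-refl))) n≤)

-- Completion of a finite symmetric bifix code.

theorem8p2 : ExcludedMiddle 0ℓ →
    ∀ (A : Set) (k : ℕ) → A ↔ Fin k →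
    ∀ (θ : A → A) → Involutive _≡_ θ →
    ∀ (S : WordSet A) → Laminary θ S → UniformlyRecurrent S →
    ∀ (X : WordSet A) → Finite X → Symmetric θ X → BifixCode X → X ⊆ S →
    ∃ λ (Y : WordSet A) → Finite Y × Symmetric θ Y × MaximalBifixCode S Y × X ⊆ Y
theorem8p2 em A k A↔k θ θ-inv S lam ur X finX symX bifX X⊆S
  with d , short ← length-bound finX
  with Parses.reaches-or-max em X bifX S ([]∈S S em ur) d
... | inj₂ (u , Su , maxu) = X , finX , symX
    , suffixDense⇒maximal S em (Laminary.biextendable lam) bifX X⊆S (Parses.max⇒suffixDense em X bifX ur Su maxu)
    , id
... | inj₁ (u , Su , d≤Lu) = Minimal S , bounded⇒finite em A↔k (proj₁ bounded) (proj₂ bounded) , symY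
    , suffixDense⇒maximal S em (Laminary.biextendable lam)
        (symmetric-suffix⇒bifix θ θ-inv symY minimal-nonempty minimal-suffix)
        Minimal.inS (minimal-suffixDense ur Su d≤Lu)
    , X⊆Minimal X⊆S short
  where
  open Parses em X bifX
  open Truncation d
  bounded : ∃ λ n → ∀ {w} → Minimal S w → length w ≤ n
  bounded = minimal-bounded ur Su d≤Lu
  symY : Symmetric θ (Minimal S)
  symY = minimal-symmetric θ θ-inv symX (Laminary.symmetric lam)
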